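{- The folded component $\mathcal{F}$ (the graph specified in the context) satisfies $\mathrm{diam}(\mathcal{F})=\frac12(\mathrm{ord}(\ell)+1)$.
   Context: Let $p$ be a prime with $p\equiv 71$ or $119\pmod{120}$, let $\ell=2$, and let $\mathrm{ord}(\ell)$ be the order, in the ideal class group of $\mathbb{Q}(\sqrt{ -p})$, of a prime ideal above $2$; it is an odd integer $\ge 3$. The folded component $\mathcal{F}$ (a component of the supersingular $2$-isogeny graph over $\mathbb{F}_p$ after identifying curves up to $\overline{\mathbb{F}_p}$-isomorphism, regarded as a simple undirected graph) is labelled so that $V(\mathcal{F})=\{0,1,\dots,\mathrm{ord}(\ell)-1\}$ and $$E(\mathcal{F})=\{\{2k-1,2k+1\}: 1\le k\le \tfrac12(\mathrm{ord}(\ell)-3)\}\cup\{\{2k+1,2k+2\}:0\le k\le \tfrac12(\mathrm{ord}(\ell)-3)\}\cup\{\{0,1\}\}.$$ The diameter is the maximum graph distance between two vertices. -}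

module Defs where

open import Data.Fin.Base using (Fin; toℕ)
open import Data.Integer.Base as ℤ using (ℤ; +_)
open import Data.List.Base using (List; foldl)
open import Data.Nat.Base using (ℕ; zero; suc; _+_; _*_; _∸_; _≤_; _<_; _/_; z≤n; s≤s)
open import Data.Nat.Properties using (<-irrefl; n<1+n; +-comm; +-monoʳ-<; m∸n≤m; ≤-<-trans)
open import Data.Product.Base using (∃; ∃₂; _×_)
open import Data.Rational.Base as ℚ using (ℚ)
open import Data.Sum.Base using (_⊎_)
open import Function.Base using (_on_)
open import Level using (0ℓ)
open import Relation.Binary.Construct.Closure.Symmetric using (SymClosure; fwd; bwd; symmetric)
open import Relation.Binary.Core using (Rel)
open import Relation.Binary.Definitions using (Symmetric)
open import Relation.Binary.PropositionalEquality using (_≡_; refl)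
open import Relation.Nullary using (¬_)
open import Relation.Unary using (Pred; _∈_; _∉_; _⊆_; _≐_)

-- The field K = ℚ(√-d), its ring of integers and its ideal classes.
module ImaginaryQuadratic (d : ℕ) where

  infixl 6 _⊕_
  infixl 7 _⊙_ _·_ _⊗_
  infixr 8 _^_
  infix  4 _∼_

  -- ⟨ a , b ⟩ stands for a + b√-d.
  record K : Set where
    constructor ⟨_,_⟩
    field
      re im : ℚ

  fromℤ : ℤ → K
  fromℤ n = ⟨ n ℚ./ 1 , ℚ.0ℚ ⟩

  0K 1K : K
  0K = fromℤ (+ 0)
  1K = fromℤ (+ 1)

  _⊕_ _⊙_ : K → K → K
  ⟨ a , b ⟩ ⊕ ⟨ a′ , b′ ⟩ = ⟨ a ℚ.+ a′ , b ℚ.+ b′ ⟩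
  ⟨ a , b ⟩ ⊙ ⟨ a′ , b′ ⟩ =
    ⟨ a ℚ.* a′ ℚ.- (+ d ℚ./ 1) ℚ.* (b ℚ.* b′) , a ℚ.* b′ ℚ.+ b ℚ.* a′ ⟩

  -- Horner evaluation at x of the monic polynomial whose remaining
  -- coefficients, from the highest degree down, are cs.
  evalMonic : List ℤ → K → K
  evalMonic cs x = foldl (λ acc c → acc ⊙ x ⊕ fromℤ c) 1K cs

  -- The ring of integers: elements of K integral over ℤ.
  𝒪 : Pred K 0ℓ
  𝒪 x = ∃ λ cs → evalMonic cs x ≡ 0K

  -- Closure under negation follows from absorption, as -1 ∈ 𝒪.
  record IsIdeal (I : Pred K 0ℓ) : Set where
    field
      integral : I ⊆ 𝒪
      0∈       : 0K ∈ I
      +-closed : ∀ {x y} → x ∈ I → y ∈ I → x ⊕ y ∈ I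
      absorbs  : ∀ {r x} → r ∈ 𝒪 → x ∈ I → r ⊙ x ∈ I

  record IsPrimeIdeal (I : Pred K 0ℓ) : Set where
    field
      isIdeal : IsIdeal I
      proper  : 1K ∉ I
      prime   : ∀ {x y} → x ∈ 𝒪 → y ∈ 𝒪 → x ⊙ y ∈ I → x ∈ I ⊎ y ∈ I

  data _⊗_ (I J : Pred K 0ℓ) : Pred K 0ℓ where
    zero : 0K ∈ I ⊗ J
    prod : ∀ {x y} → x ∈ I → y ∈ J → x ⊙ y ∈ I ⊗ J
    plus : ∀ {x y} → x ∈ I ⊗ J → y ∈ I ⊗ J → x ⊕ y ∈ I ⊗ J

  _^_ : Pred K 0ℓ → ℕ → Pred K 0ℓ
  I ^ zero  = 𝒪
  I ^ suc n = I ⊗ I ^ n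

  _·_ : K → Pred K 0ℓ → Pred K 0ℓ
  (α · I) x = ∃ λ y → y ∈ I × x ≡ α ⊙ y

  -- Equality of ideal classes: I = αJ for some α ∈ K*.
  _∼_ : Rel (Pred K 0ℓ) _
  I ∼ J = ∃ λ α → ¬ α ≡ 0K × I ≐ α · J

  -- n is the order of the class of I in the ideal class group,
  -- whose identity is the class of 𝒪.
  record IsClassOrder (I : Pred K 0ℓ) (n : ℕ) : Set where
    field
      positive : 1 ≤ n
      trivial  : I ^ n ∼ 𝒪
      minimal  : ∀ m → 1 ≤ m → I ^ m ∼ 𝒪 → n ≤ m

record SimpleGraph : Set₁ where
  field
    Vertex     : Set
    Adj        : Rel Vertex 0ℓ
    Adj-sym    : Symmetric Adj
    Adj-irrefl : ∀ {u} → ¬ Adj u u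

module _ (G : SimpleGraph) where
  open SimpleGraph G

  data Walk : Vertex → Vertex → ℕ → Set where
    []  : ∀ {u} → Walk u u 0
    _∷_ : ∀ {u v w k} → Adj u v → Walk v w k → Walk u w (suc k)

  IsDistance : Vertex → Vertex → ℕ → Set
  IsDistance u v d = Walk u v d × (∀ k → Walk u v k → d ≤ k)

  -- In particular any two vertices are joined by a walk.
  IsDiameter : ℕ → Set
  IsDiameter D =
    (∀ u v → ∃ λ d → IsDistance u v d × d ≤ D) × ∃₂ λ u v → IsDistance u v D

-- The divisions and subtractions are exact for odd n ≥ 3, the only case of
-- interest.
data FoldedEdge (n : ℕ) : Rel ℕ 0ℓ where
  spine : ∀ k → 1 ≤ k → k ≤ (n ∸ 3) / 2 → FoldedEdge n (2 * k ∸ 1) (2 * k + 1)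
  leg   : ∀ k → k ≤ (n ∸ 3) / 2 → FoldedEdge n (2 * k + 1) (2 * k + 2)
  base  : FoldedEdge n 0 1

FoldedEdge⇒< : ∀ {n a b} → FoldedEdge n a b → a < b
FoldedEdge⇒< (spine k _ _) rewrite +-comm (2 * k) 1 = ≤-<-trans (m∸n≤m (2 * k) 1) (n<1+n (2 * k))
FoldedEdge⇒< (leg k _)     = +-monoʳ-< (2 * k) (n<1+n 1)
FoldedEdge⇒< base          = s≤s z≤n

-- n plays the role of ord(ℓ).
foldedComponent : ℕ → SimpleGraph
foldedComponent n = record
  { Vertex     = Fin n
  ; Adj        = SymClosure (FoldedEdge n on toℕ)
  ; Adj-sym    = symmetric (FoldedEdge n on toℕ)
  ; Adj-irrefl = λ { (fwd e) → <-irrefl refl (FoldedEdge⇒< e)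
                   ; (bwd e) → <-irrefl refl (FoldedEdge⇒< e) }
  }

{-# OPTIONS --safe #-}

-- The graph is a caterpillar: the odd vertices form a path, and each even
-- vertex is a leaf hanging from it.  Two distinct vertices are at distance
-- height + (distance of their feet along the path) + height, because this
-- quantity is at most 1 across an edge and satisfies a triangle inequality.
-- With h + 1 path vertices it is at most h + 2, attained by the leaves 0 and
-- 2h + 2, where ord = 2h + 3.
module Submission where

open import Defs
open import Data.Fin.Base using (Fin; zero; suc; toℕ; fromℕ; fromℕ<)
open import Data.Fin.Properties using (_≟_; toℕ-injective; toℕ-fromℕ; toℕ-fromℕ<; toℕ≤pred[n])
open import Data.Integer.Base using (+_)
open import Data.Nat.Base using (ℕ; zero; suc; pred; _+_; _*_; _∸_; _≤_; _/_; _%_; ∣_-_∣; z≤n; s≤s; s≤s⁻¹)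
open import Data.Nat.DivMod using (m≡m%n+[m/n]*n; m*n/n≡m; m*n%n≡0; [m+kn]%n≡m%n; m%n<n; +-distrib-/-∣ʳ; /-monoˡ-≤)
open import Data.Nat.Divisibility using (n∣m*n)
open import Data.Nat.Primality using (Prime)
open import Data.Nat.Properties hiding (_≟_)
open import Data.Product.Base using (∃; _×_; _,_)
open import Data.Sum.Base using (_⊎_; inj₁; inj₂)
open import Level using (0ℓ)
open import Relation.Binary.Construct.Closure.Symmetric using (fwd; bwd)
open import Relation.Binary.PropositionalEquality using (_≡_; _≢_; refl; sym; trans; cong; cong₂; subst; subst₂; module ≡-Reasoning)
open import Relation.Nullary using (yes; no; contradiction)
open import Relation.Unary using (Pred; _∈_)

module _ {G : SimpleGraph} where
  open SimpleGraph G

  _++_ : ∀ {u v w k l} → Walk G u v k → Walk G v w l → Walk G u w (k + l)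
  []       ++ ys = ys
  (e ∷ xs) ++ ys = e ∷ (xs ++ ys)

  reverse : ∀ {u v k} → Walk G u v k → Walk G v u k
  reverse []                   = []
  reverse {k = suc k} (e ∷ xs) =
    subst (Walk G _ _) (+-comm k 1) (reverse xs ++ (Adj-sym e ∷ []))

-- The path vertex 1 + 2 * foot a is a itself or the neighbour of the leaf a.
foot : ℕ → ℕ
foot a = pred a / 2

-- The number of edges from `a` to its path vertex. The label 0 is a leaf hanging from 1; it needs
-- its own clause, and `pred 0 = 0` gives it foot 0.
height : ℕ → ℕ
height zero    = 1
height (suc a) = a % 2

foot-odd : ∀ k → foot (1 + k * 2) ≡ k
foot-odd k = m*n/n≡m k 2

height-odd : ∀ k → height (1 + k * 2) ≡ 0
height-odd k = m*n%n≡0 k 2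

foot-even : ∀ k → foot (2 + k * 2) ≡ k
foot-even k = trans (+-distrib-/-∣ʳ 1 {d = 2} (n∣m*n k)) (m*n/n≡m k 2)

height-even : ∀ k → height (2 + k * 2) ≡ 1
height-even k = [m+kn]%n≡m%n 1 k 2

height≤1 : ∀ a → height a ≤ 1
height≤1 zero    = ≤-refl
height≤1 (suc a) = s≤s⁻¹ (m%n<n a 2)

-- The distance between distinct vertices only: dist a a is 2 at a leaf a.
dist : ℕ → ℕ → ℕ
dist a b = height a + (∣ foot a - foot b ∣ + height b)

dist-sym : ∀ a b → dist a b ≡ dist b a
dist-sym a b = begin
  height a + (∣ foot a - foot b ∣ + height b)  ≡⟨ +-comm (height a) _ ⟩
  ∣ foot a - foot b ∣ + height b + height a    ≡⟨ cong (_+ height a) (+-comm _ (height b)) ⟩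
  height b + ∣ foot a - foot b ∣ + height a    ≡⟨ +-assoc (height b) _ _ ⟩
  height b + (∣ foot a - foot b ∣ + height a)  ≡⟨ cong (λ x → height b + (x + height a)) (∣-∣-comm (foot a) (foot b)) ⟩
  height b + (∣ foot b - foot a ∣ + height a)  ∎
  where open ≡-Reasoning

-- The feet obey the triangle inequality on the line, and the two copies of `height b` only enlarge
-- the right side.
dist-triangle : ∀ a b c → dist a c ≤ dist a b + dist b c
dist-triangle a b c = begin
  height a + (∣ foot a - foot c ∣ + height c)
    ≤⟨ +-monoʳ-≤ (height a) (+-monoˡ-≤ (height c) (∣-∣-triangle (foot a) (foot b) (foot c))) ⟩
  height a + (∣ foot a - foot b ∣ + ∣ foot b - foot c ∣ + height c)
    ≡⟨ cong (λ x → height a + x) (+-assoc ∣ foot a - foot b ∣ _ _) ⟩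
  height a + (∣ foot a - foot b ∣ + (∣ foot b - foot c ∣ + height c))
    ≡⟨ +-assoc (height a) _ _ ⟨
  height a + ∣ foot a - foot b ∣ + (∣ foot b - foot c ∣ + height c)
    ≤⟨ +-mono-≤ (+-monoʳ-≤ (height a) (m≤m+n _ (height b))) (m≤n+m _ (height b)) ⟩
  dist a b + dist b c ∎
  where open ≤-Reasoning

-- Puts edge endpoints into the form `c + k * 2`, in which the foot and height lemmas are stated.
2k+c≡c+k2 : ∀ k c → 2 * k + c ≡ c + k * 2
2k+c≡c+k2 k c = trans (+-comm (2 * k) c) (cong (λ x → c + x) (*-comm 2 k))

2[1+k]∸1≡1+k2 : ∀ k → 2 * suc k ∸ 1 ≡ 1 + k * 2
2[1+k]∸1≡1+k2 k = cong (_∸ 1) (*-comm 2 (suc k))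

dist-spine : ∀ k → dist (1 + k * 2) (1 + suc k * 2) ≡ 1
dist-spine k
  rewrite foot-odd k | height-odd k | foot-odd (suc k)
        = trans (+-identityʳ _) (trans (cong ∣ k -_∣ (+-comm 1 k)) (∣m-m+n∣≡n k 1))

dist-leg : ∀ k → dist (1 + k * 2) (2 + k * 2) ≡ 1
dist-leg k
  rewrite foot-odd k | height-odd k | foot-even k | height-even k
        = cong (_+ 1) (∣n-n∣≡0 k)

dist-edge : ∀ {n a b} → FoldedEdge n a b → dist a b ≡ 1
dist-edge (spine (suc k) _ _) =
  trans (cong₂ dist (2[1+k]∸1≡1+k2 k) (2k+c≡c+k2 (suc k) 1)) (dist-spine k)
dist-edge (leg k _) = trans (cong₂ dist (2k+c≡c+k2 k 1) (2k+c≡c+k2 k 2)) (dist-leg k)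
dist-edge base      = refl

module _ (h : ℕ) where
  private
    n : ℕ
    n = 3 + h * 2

    G : SimpleGraph
    G = foldedComponent n

  open SimpleGraph G using (Adj)

  dist-Adj : ∀ {u v} → Adj u v → dist (toℕ u) (toℕ v) ≡ 1
  dist-Adj         (fwd e) = dist-edge e
  dist-Adj {u} {v} (bwd e) = trans (dist-sym (toℕ u) (toℕ v)) (dist-edge e)

  -- Each edge adds 1 to the bound, by the triangle inequality. Equal endpoints are split off
  -- because the empty walk at a leaf would violate it.
  walk⇒dist≤ : ∀ {u v k} → Walk G u v k → u ≡ v ⊎ dist (toℕ u) (toℕ v) ≤ k
  walk⇒dist≤ [] = inj₁ refl
  walk⇒dist≤ {u} {v} (_∷_ {v = w} e xs) with walk⇒dist≤ xs
  -- The tail returns to its start, so the first edge alone gives `dist` equal to 1.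
  ... | inj₁ refl = inj₂ (≤-trans (≤-reflexive (dist-Adj e)) (s≤s z≤n))
  ... | inj₂ d≤k  = inj₂ (≤-trans (dist-triangle (toℕ u) (toℕ w) (toℕ v))
                                  (+-mono-≤ (≤-reflexive (dist-Adj e)) d≤k))

  foot≤h : ∀ (u : Fin n) → foot (toℕ u) ≤ h
  foot≤h u = subst (foot (toℕ u) ≤_) (foot-even h)
                   (/-monoˡ-≤ 2 (pred-mono-≤ (toℕ≤pred[n] u)))

  dist≤2+h : ∀ (u v : Fin n) → dist (toℕ u) (toℕ v) ≤ 2 + h
  dist≤2+h u v = begin
    dist (toℕ u) (toℕ v)
      ≤⟨ +-mono-≤ (height≤1 (toℕ u)) (+-mono-≤
           (≤-trans (∣m-n∣≤m⊔n (foot (toℕ u)) _) (⊔-lub (foot≤h u) (foot≤h v))) (height≤1 (toℕ v))) ⟩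
    1 + (h + 1)  ≡⟨ cong suc (+-comm h 1) ⟩
    2 + h        ∎
    where open ≤-Reasoning

  edge⇒Adj : ∀ {u v a b} → FoldedEdge n a b → a ≡ toℕ u → b ≡ toℕ v → Adj u v
  edge⇒Adj e p q = fwd (subst₂ (FoldedEdge n) p q e)

  ≤h⇒≤ : ∀ {k} → k ≤ h → k ≤ (n ∸ 3) / 2
  ≤h⇒≤ {k} = subst (k ≤_) (sym (m*n/n≡m h 2))

  odd<n⇒≤h : ∀ k (u : Fin n) → toℕ u ≡ 1 + k * 2 → k ≤ h
  odd<n⇒≤h k u p = subst (_≤ h) (trans (cong foot p) (foot-odd k)) (foot≤h u)

  vertex : ∀ a → a ≤ 2 + h * 2 → ∃ λ (u : Fin n) → toℕ u ≡ a
  vertex a a≤ = fromℕ< (s≤s a≤) , toℕ-fromℕ< (s≤s a≤)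

  ascend : ∀ i d {u v : Fin n} → toℕ u ≡ 1 + i * 2 → toℕ v ≡ 1 + (d + i) * 2 → Walk G u v d
  ascend i zero p q with refl ← toℕ-injective (trans p (sym q)) = []
  ascend i (suc d) {u} {v} p q
    -- The end of the walk is a vertex, so its index `suc d + i` is at most `h`; hence the next path
    -- vertex exists and the edge to it is in range.
    with 1+i≤h ← ≤-trans (s≤s (m≤n+m i d)) (odd<n⇒≤h (suc d + i) v q)
    with w , r ← vertex (3 + i * 2) (s≤s (≤-trans (*-monoˡ-≤ 2 1+i≤h) (n≤1+n _)))
    = edge⇒Adj (spine (suc i) (s≤s z≤n) (≤h⇒≤ 1+i≤h))
               (trans (2[1+k]∸1≡1+k2 i) (sym p))
               (trans (2k+c≡c+k2 (suc i) 1) (sym r))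
    ∷ ascend (suc i) d r (trans q (cong (λ x → 1 + x * 2) (sym (+-suc d i))))

  pathWalk : ∀ i j {u v : Fin n} → toℕ u ≡ 1 + i * 2 → toℕ v ≡ 1 + j * 2 → Walk G u v ∣ i - j ∣
  pathWalk i j p q with ≤-total i j
  ... | inj₁ i≤j rewrite m≤n⇒∣m-n∣≡n∸m i≤j =
    ascend i (j ∸ i) p (trans q (cong (λ x → 1 + x * 2) (sym (m∸n+n≡m i≤j))))
  ... | inj₂ j≤i rewrite m≤n⇒∣n-m∣≡n∸m j≤i =
    reverse (ascend j (i ∸ j) q (trans p (cong (λ x → 1 + x * 2) (sym (m∸n+n≡m j≤i)))))

  toFoot : ∀ (u : Fin n) → ∃ λ w → toℕ w ≡ 1 + foot (toℕ u) * 2 × Walk G u w (height (toℕ u))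
  toFoot zero = suc zero , refl , edge⇒Adj base refl refl ∷ []
  -- The remainder is that of the predecessor of the label: 0 means that `u` is on the path, 1 that
  -- it is a leaf. The division identity recovers the label from the foot.
  toFoot u@(suc u′) with toℕ u′ % 2 | m≡m%n+[m/n]*n (toℕ u′) 2 | m%n<n (toℕ u′) 2
  ... | 0 | p | _ = u , cong suc p , []
  ... | 1 | p | _ with w , r ← vertex (1 + foot (toℕ u) * 2) (s≤s (≤-trans (*-monoˡ-≤ 2 (foot≤h u)) (n≤1+n _))) =
    w , r , SimpleGraph.Adj-sym G
      (edge⇒Adj (leg (foot (toℕ u)) (≤h⇒≤ (foot≤h u)))
        (trans (2k+c≡c+k2 (foot (toℕ u)) 1) (sym r))
        (trans (2k+c≡c+k2 (foot (toℕ u)) 2) (cong suc (sym p)))) ∷ []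
  ... | suc (suc _) | _ | s≤s (s≤s ())

  -- Go to the foot of `u`, along the path, then out to `v`. For `u = v` a leaf this is a closed
  -- walk of length 2.
  distWalk : ∀ (u v : Fin n) → Walk G u v (dist (toℕ u) (toℕ v))
  distWalk u v with u₁ , p , xs ← toFoot u | v₁ , q , ys ← toFoot v =
    xs ++ (pathWalk (foot (toℕ u)) (foot (toℕ v)) p q ++ reverse ys)

  dist-isDistance : ∀ {u v : Fin n} → u ≢ v → IsDistance G u v (dist (toℕ u) (toℕ v))
  dist-isDistance {u} {v} u≢v = distWalk u v , shortest
    where
    shortest : ∀ k → Walk G u v k → dist (toℕ u) (toℕ v) ≤ k
    shortest k xs with walk⇒dist≤ xs
    ... | inj₁ u≡v = contradiction u≡v u≢v
    ... | inj₂ d≤k = d≤k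

  dist-extremal : dist 0 (toℕ (fromℕ (2 + h * 2))) ≡ 2 + h
  dist-extremal rewrite toℕ-fromℕ (h * 2) | foot-even h | height-even h = cong suc (+-comm h 1)

  foldedComponent-diameter : IsDiameter G (2 + h)
  foldedComponent-diameter = bounded , zero , fromℕ (2 + h * 2) ,
    subst (IsDistance G _ _) dist-extremal (dist-isDistance λ ())
    where
    bounded : ∀ u v → ∃ λ d → IsDistance G u v d × d ≤ 2 + h
    bounded u v with u ≟ v
    -- The distance is 0 here, whereas `dist` would give 2 at a leaf.
    ... | yes refl = 0 , ([] , λ _ _ → z≤n) , z≤n
    ... | no u≢v   = dist (toℕ u) (toℕ v) , dist-isDistance u≢v , dist≤2+h u v

-- Division by 2 gives `m = 1 + (m / 2) * 2`; the quotient is nonzero since `3 ≤ m`, and `h` is its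
-- predecessor.
odd≥3⇒≡3+h*2 : ∀ m → m % 2 ≡ 1 → 3 ≤ m → ∃ λ h → m ≡ 3 + h * 2
odd≥3⇒≡3+h*2 m odd 3≤m with m / 2 | trans (m≡m%n+[m/n]*n m 2) (cong (_+ m / 2 * 2) odd)
... | zero  | refl = contradiction 3≤m λ { (s≤s ()) }
... | suc h | p    = h , p

theorem31 : (p : ℕ) → Prime p → (p % 120 ≡ 71) ⊎ (p % 120 ≡ 119) →
    let open ImaginaryQuadratic p in
    (𝔭 : Pred K 0ℓ) → IsPrimeIdeal 𝔭 → fromℤ (+ 2) ∈ 𝔭 →
    (ord : ℕ) → IsClassOrder 𝔭 ord → ord % 2 ≡ 1 → 3 ≤ ord →
    IsDiameter (foldedComponent ord) ((ord + 1) / 2)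
theorem31 _ _ _ _ _ _ ord _ odd 3≤ord with h , refl ← odd≥3⇒≡3+h*2 ord odd 3≤ord =
  subst (IsDiameter (foldedComponent (3 + h * 2))) 2+h≡ (foldedComponent-diameter h)
  where
  2+h≡ : 2 + h ≡ (3 + h * 2 + 1) / 2
  -- Once the final 1 is moved to the front, the numerator computes to `(2 + h) * 2`.
  2+h≡ = sym (trans (cong (_/ 2) (+-comm (3 + h * 2) 1)) (m*n/n≡m (2 + h) 2))
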